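{- Let $t\geq 2$ and let $\Gamma$ be a $t$-walk-regular graph with valency $k$ which has a $t$-walk-regular idempotent of rank at most $t$ for an eigenvalue $\theta\neq\pm k$. Then $\Gamma$ is distance-regular.
   Context: All graphs are finite, simple and connected, with adjacency matrix $A$; $A_j$ denotes the distance-$j$ matrix ($(A_j)_{xy}=1$ iff $\mathrm{dist}(x,y)=j$). A graph is $t$-walk-regular if it has diameter at least $t$ and for every $\ell\geq 0$ the number of walks of length $\ell$ between $x$ and $y$ depends only on $\mathrm{dist}(x,y)$ whenever $\mathrm{dist}(x,y)\leq t$; such a graph is regular. A $t$-walk-regular idempotent for an eigenvalue $\theta$ is a nonzero real symmetric matrix $E$ with $E^2=E$, $AE=\theta E$, and constants $\alpha_0,\dots,\alpha_t$ with $A_j\circ E=\alpha_j A_j$ for $0\leq j\leq t$ ($\circ$ the entrywise product). A graph of diameter $D$ is distance-regular if for all $0\leq j\leq D$ and all vertices $x,y$ with $\mathrm{dist}(x,y)=j$, the numbers of neighbors of $y$ at distance $j-1$, $j$, $j+1$ from $x$ depend only on $j$. -}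

module Defs where

open import Level using (0ℓ)
open import Data.Nat using (ℕ; zero; suc) renaming (_+_ to _+ℕ_; _*_ to _*ℕ_; _≤_ to _≤ℕ_)
open import Data.Nat.Properties using (_≟_)
open import Data.Fin using (Fin; zero; suc)
open import Data.Bool using (Bool; true; false; _∧_; not; if_then_else_)
open import Data.Product using (Σ; ∃; ∃-syntax; _×_; _,_)
open import Relation.Nullary using (¬_)
open import Relation.Nullary.Decidable using (⌊_⌋)
open import Relation.Binary.PropositionalEquality using (_≡_)
open import Algebra.Structures using (IsCommutativeRing)
open import Relation.Binary.Structures using (IsTotalOrder)

-- The real numbers, axiomatised as a complete ordered field
-- (every model is isomorphic to ℝ).

record Reals : Set₁ where
  infix  4 _≈_ _≤_
  infixl 6 _+_
  infixl 7 _*_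
  field
    Carrier : Set
    _≈_     : Carrier → Carrier → Set
    _+_ _*_ : Carrier → Carrier → Carrier
    -_      : Carrier → Carrier
    0# 1#   : Carrier
    isCommutativeRing : IsCommutativeRing _≈_ _+_ _*_ -_ 0# 1#
    0≉1     : ¬ (0# ≈ 1#)
    inverse : ∀ x → ¬ (x ≈ 0#) → ∃[ y ] (x * y ≈ 1#)
    _≤_          : Carrier → Carrier → Set
    isTotalOrder : IsTotalOrder _≈_ _≤_
    +-mono-≤     : ∀ {x y} z → x ≤ y → x + z ≤ y + z
    *-nonneg     : ∀ {x y} → 0# ≤ x → 0# ≤ y → 0# ≤ x * y
    lub : (P : Carrier → Set) → ∃[ x ] P x → ∃[ b ] (∀ x → P x → x ≤ b) →
          ∃[ s ] ((∀ x → P x → x ≤ s) × (∀ b → (∀ x → P x → x ≤ b) → s ≤ b))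

  fromℕ : ℕ → Carrier
  fromℕ zero    = 0#
  fromℕ (suc n) = 1# + fromℕ n

∑ : {A : Set} → A → (A → A → A) → (n : ℕ) → (Fin n → A) → A
∑ z _⊕_ zero    f = z
∑ z _⊕_ (suc n) f = f zero ⊕ ∑ z _⊕_ n (λ i → f (suc i))

∑ℕ : (n : ℕ) → (Fin n → ℕ) → ℕ
∑ℕ = ∑ 0 _+ℕ_

record Graph : Set where
  field
    n     : ℕ
    adj   : Fin n → Fin n → Bool
    sym   : ∀ x y → adj x y ≡ adj y x
    irrefl : ∀ x → adj x x ≡ false

  toℕ𝔹 : Bool → ℕ
  toℕ𝔹 true  = 1
  toℕ𝔹 false = 0

  _==_ : Fin n → Fin n → Bool
  x == y = ⌊ Data.Fin._≟_ x y ⌋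

  walks : ℕ → Fin n → Fin n → ℕ
  walks zero    x y = toℕ𝔹 (x == y)
  walks (suc ℓ) x y = ∑ℕ n (λ z → toℕ𝔹 (adj x z) *ℕ walks ℓ z y)

  isZero : ℕ → Bool
  isZero zero    = true
  isZero (suc _) = false

  noWalkBelow : ℕ → Fin n → Fin n → Bool
  noWalkBelow zero    x y = true
  noWalkBelow (suc j) x y = noWalkBelow j x y ∧ isZero (walks j x y)

  distIs : Fin n → Fin n → ℕ → Bool
  distIs x y j = noWalkBelow j x y ∧ not (isZero (walks j x y))

  Dist : Fin n → Fin n → ℕ → Set
  Dist x y j = distIs x y j ≡ true

  Connected : Set
  Connected = ∀ x y → ∃[ j ] Dist x y j

  degree : Fin n → ℕ
  degree x = ∑ℕ n (λ z → toℕ𝔹 (adj x z))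

  Regular : ℕ → Set
  Regular k = ∀ x → degree x ≡ k

  DiameterAtLeast : ℕ → Set
  DiameterAtLeast t = ∃[ x ] ∃[ y ] Dist x y t

  IsDiameter : ℕ → Set
  IsDiameter D = (∀ x y → ∃[ j ] (j ≤ℕ D × Dist x y j)) × DiameterAtLeast D

  WalkRegular : ℕ → Set
  WalkRegular t = DiameterAtLeast t ×
    (∀ ℓ j x y x' y' → j ≤ℕ t → Dist x y j → Dist x' y' j → walks ℓ x y ≡ walks ℓ x' y')

  nbAt : Fin n → Fin n → ℕ → ℕ
  nbAt x y i = ∑ℕ n (λ z → toℕ𝔹 (adj y z ∧ distIs x z i))

  DistanceRegular : Set
  DistanceRegular = ∃[ D ] (IsDiameter D ×
    (∀ j x y x' y' → j ≤ℕ D → Dist x y j → Dist x' y' j →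
        (∀ i → j ≡ suc i → nbAt x y i ≡ nbAt x' y' i)
      × (nbAt x y j ≡ nbAt x' y' j)
      × (nbAt x y (suc j) ≡ nbAt x' y' (suc j))))

module _ (ℝ : Reals) (Γ : Graph) where
  open Reals ℝ
  open Graph Γ

  Mat : Set
  Mat = Fin n → Fin n → Carrier

  ∑ℝ : (Fin n → Carrier) → Carrier
  ∑ℝ = ∑ 0# _+_ n

  Aℝ : Mat
  Aℝ x y = if adj x y then 1# else 0#

  _·_ : Mat → Mat → Mat
  (M · N) x y = ∑ℝ (λ z → M x z * N z y)

  RankAtMost : ℕ → Mat → Set
  RankAtMost r M = Σ (Fin r → Fin n → Carrier) λ v →
    ∀ y → Σ (Fin r → Carrier) λ c → ∀ x → M x y ≈ ∑ 0# _+_ r (λ i → c i * v i x)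

  WalkRegularIdempotent : ℕ → Carrier → Mat → Set
  WalkRegularIdempotent t θ E =
      (∃[ x ] ∃[ y ] ¬ (E x y ≈ 0#))
    × (∀ x y → E x y ≈ E y x)
    × (∀ x y → (E · E) x y ≈ E x y)
    × (∀ x y → (Aℝ · E) x y ≈ θ * E x y)
    × Σ (ℕ → Carrier) λ α → (∀ j x y → j ≤ℕ t → Dist x y j → E x y ≈ α j) -- A_j ∘ E = α_j A_j

{-# OPTIONS --safe #-}
module Submission where

-- Write the rows of E as vectors.  Let x be at distance m ≥ t from y and suppose y had two neighbours
-- z ≠ z′ at distance m + 1 from x.  The Gram matrix of the vectors along a geodesic is the Toeplitz matrix
-- of the α's, so the t + 1 first vectors of a geodesic of length m + 1 satisfy a linear relation that does
-- not depend on the geodesic.  Comparing a geodesic through z with one through z′ shows that z and z′ have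
-- the same vector, so α₁ = α₀ or α₂ = α₀, and then θ = k or θ² = k².  Hence every y at distance m from x has
-- at most one neighbour y⁺ at distance m + 1, and counting the walks from x to y by their last step
-- expresses the number of walks from x to y⁺ through distances at most m.  So Γ is s-walk-regular for all s,
-- and the walk counts determine the intersection numbers.

open import Defs
open import Algebra.Bundles using (CommutativeRing; CommutativeSemiring)
import Algebra.Properties.Ring as RingProperties
import Algebra.Properties.Semiring.Sum as SemiringSum
open import Data.Bool using (Bool; true; false; _∧_; not)
open import Data.Empty using (⊥)
open import Data.Fin using (Fin; zero; suc; toℕ; punchIn; punchOut)
import Data.Fin.Properties as Fin
open import Data.Nat as ℕ using (ℕ; zero; suc; z≤n; s≤s; s≤s⁻¹; ∣_-_∣)
import Data.Nat.Properties as ℕ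
open import Data.Product using (Σ; ∃-syntax; _×_; _,_; proj₁; proj₂)
open import Data.Sum using (_⊎_; inj₁; inj₂)
open import Level using (0ℓ)
open import Relation.Binary.Bundles using (TotalOrder)
open import Relation.Binary.PropositionalEquality as ≡ using (_≡_; _≢_)
import Relation.Binary.Reasoning.PartialOrder as PartialOrderReasoning
import Relation.Binary.Reasoning.Setoid as SetoidReasoning
open import Relation.Nullary using (¬_; Dec; yes; no; contradiction)
open import Relation.Nullary.Decidable using (¬?)

-- Finite sums over a commutative semiring, used for both natural and real numbers.

module Sums (R : CommutativeSemiring 0ℓ 0ℓ) where
  open CommutativeSemiring R hiding (zero)
  open SemiringSum semiring using (sum; ∑-distrib-+; ∑-comm;
    *-distribˡ-sum; *-distribʳ-sum)

  ∑≈sum : ∀ m (f : Fin m → Carrier) → ∑ 0# _+_ m f ≈ sum f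
  ∑≈sum zero    f = refl
  ∑≈sum (suc m) f = +-congˡ (∑≈sum m (λ i → f (suc i)))

  ∑-cong : ∀ m {f g : Fin m → Carrier} → (∀ i → f i ≈ g i) → ∑ 0# _+_ m f ≈ ∑ 0# _+_ m g
  ∑-cong zero    f≈g = refl
  ∑-cong (suc m) f≈g = +-cong (f≈g zero) (∑-cong m (λ i → f≈g (suc i)))

  ∑-zero : ∀ m {f : Fin m → Carrier} → (∀ i → f i ≈ 0#) → ∑ 0# _+_ m f ≈ 0#
  ∑-zero zero    f≈0 = refl
  ∑-zero (suc m) f≈0 = trans (+-cong (f≈0 zero) (∑-zero m (λ i → f≈0 (suc i)))) (+-identityˡ 0#)

  ∑-+ : ∀ m (f g : Fin m → Carrier) →
        ∑ 0# _+_ m (λ i → f i + g i) ≈ ∑ 0# _+_ m f + ∑ 0# _+_ m g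
  ∑-+ m f g = trans (∑≈sum m _) (trans (∑-distrib-+ f g)
    (sym (+-cong (∑≈sum m f) (∑≈sum m g))))

  ∑-*ˡ : ∀ m c (f : Fin m → Carrier) → c * ∑ 0# _+_ m f ≈ ∑ 0# _+_ m (λ i → c * f i)
  ∑-*ˡ m c f = trans (*-congˡ (∑≈sum m f)) (trans (*-distribˡ-sum c f) (sym (∑≈sum m _)))

  ∑-*ʳ : ∀ m c (f : Fin m → Carrier) → ∑ 0# _+_ m f * c ≈ ∑ 0# _+_ m (λ i → f i * c)
  ∑-*ʳ m c f = trans (*-congʳ (∑≈sum m f)) (trans (*-distribʳ-sum c f) (sym (∑≈sum m _)))

  ∑-swap : ∀ m n (f : Fin m → Fin n → Carrier) →
           ∑ 0# _+_ m (λ i → ∑ 0# _+_ n (f i)) ≈ ∑ 0# _+_ n (λ j → ∑ 0# _+_ m (λ i → f i j))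
  ∑-swap m n f = begin
    ∑ 0# _+_ m (λ i → ∑ 0# _+_ n (f i))        ≈⟨ ∑-cong m (λ i → ∑≈sum n (f i)) ⟩
    ∑ 0# _+_ m (λ i → sum (f i))               ≈⟨ ∑≈sum m _ ⟩
    sum (λ i → sum (f i))                      ≈⟨ ∑-comm f ⟩
    sum (λ j → sum (λ i → f i j))              ≈⟨ ∑≈sum n _ ⟨
    ∑ 0# _+_ n (λ j → sum (λ i → f i j))       ≈⟨ ∑-cong n (λ j → ∑≈sum m (λ i → f i j)) ⟨
    ∑ 0# _+_ n (λ j → ∑ 0# _+_ m (λ i → f i j)) ∎
    where open SetoidReasoning setoid

  ∑-single : ∀ m (f : Fin m → Carrier) i → (∀ j → j ≢ i → f j ≈ 0#) → ∑ 0# _+_ m f ≈ f i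
  ∑-single (suc m) f zero    f≈0 =
    trans (+-congˡ (∑-zero m (λ j → f≈0 (suc j) (λ ())))) (+-identityʳ _)
  ∑-single (suc m) f (suc i) f≈0 =
    trans (+-cong (f≈0 zero (λ ())) (∑-single m _ i (λ j j≢i → f≈0 (suc j) (λ { ≡.refl → j≢i ≡.refl }))))
          (+-identityˡ _)

-- Order, decidable equality with zero, and linear dependence over the reals.

module RealField (ℝ : Reals) where
  open Reals ℝ using (fromℕ; 0≉1; inverse; lub; +-mono-≤; *-nonneg; isCommutativeRing; isTotalOrder)

  commutativeRing : CommutativeRing 0ℓ 0ℓ
  commutativeRing = record { isCommutativeRing = isCommutativeRing }

  totalOrder : TotalOrder 0ℓ 0ℓ 0ℓ
  totalOrder = record { isTotalOrder = isTotalOrder }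

  open CommutativeRing commutativeRing hiding (zero; _≉_) public
  open TotalOrder totalOrder public
    using (_≤_; total; antisym; poset; ≤-respˡ-≈; ≤-respʳ-≈)
    renaming (trans to ≤-trans; reflexive to ≤-reflexive; refl to ≤-refl)
  open RingProperties ring public
  open Sums commutativeSemiring public

  0≤1 : 0# ≤ 1#
  0≤1 with total 0# 1#
  ... | inj₁ 0≤1 = 0≤1
  ... | inj₂ 1≤0 = ≤-respʳ-≈ -1*-1≈1 (*-nonneg 0≤-1 0≤-1)
    where
    0≤-1 : 0# ≤ - 1#
    0≤-1 = ≤-respˡ-≈ (-‿inverseʳ 1#) (≤-respʳ-≈ (+-identityˡ _) (+-mono-≤ (- 1#) 1≤0))
    -1*-1≈1 : - 1# * - 1# ≈ 1#
    -1*-1≈1 = trans (-1*x≈-x (- 1#)) (-‿involutive 1#)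

  1≰0 : ¬ (1# ≤ 0#)
  1≰0 1≤0 = 0≉1 (antisym 0≤1 1≤0)

  square-nonneg : ∀ x → 0# ≤ x * x
  square-nonneg x with total 0# x
  ... | inj₁ 0≤x = *-nonneg 0≤x 0≤x
  ... | inj₂ x≤0 = ≤-respʳ-≈ -x*-x≈x*x (*-nonneg 0≤-x 0≤-x)
    where
    0≤-x : 0# ≤ - x
    0≤-x = ≤-respˡ-≈ (-‿inverseʳ x) (≤-respʳ-≈ (+-identityˡ _) (+-mono-≤ (- x) x≤0))
    -x*-x≈x*x : - x * - x ≈ x * x
    -x*-x≈x*x = trans (sym (-‿distribˡ-* x (- x)))
      (trans (-‿cong (sym (-‿distribʳ-* x x))) (-‿involutive (x * x)))

  -- The supremum s of {0} ∪ {2 | Q} lies below or above 1, which decides ¬ Q.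
  weakLEM : (Q : Set) → ¬ Q ⊎ ¬ ¬ Q
  weakLEM Q with lub (λ z → (z ≈ 0#) ⊎ (z ≈ 1# + 1# × Q)) (0# , inj₁ refl)
                     (1# + 1# , λ { z (inj₁ z≈0) → ≤-trans (≤-reflexive z≈0) 0≤2
                                  ; z (inj₂ (z≈2 , _)) → ≤-reflexive z≈2 })
    where
    0≤2 : 0# ≤ 1# + 1#
    0≤2 = ≤-trans 0≤1 (≤-respˡ-≈ (+-identityˡ 1#) (+-mono-≤ 1# 0≤1))
  ... | s , s-upper , s-least with total s 1#
  ... | inj₁ s≤1 = inj₁ λ q → 1≰0 (begin
          1#               ≈⟨ +-identityʳ 1# ⟨
          1# + 0#          ≈⟨ +-congˡ (-‿inverseʳ 1#) ⟨
          1# + (1# + - 1#) ≈⟨ +-assoc _ _ _ ⟨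
          1# + 1# + - 1#   ≤⟨ +-mono-≤ (- 1#) (≤-trans (s-upper (1# + 1#) (inj₂ (refl , q))) s≤1) ⟩
          1# + - 1#        ≈⟨ -‿inverseʳ 1# ⟩
          0#               ∎)
    where open PartialOrderReasoning poset
  ... | inj₂ 1≤s = inj₂ λ ¬q → 1≰0 (≤-trans 1≤s (s-least 0#
          (λ { z (inj₁ z≈0) → ≤-reflexive z≈0 ; z (inj₂ (_ , q)) → contradiction q ¬q })))

  -- Let s be the supremum of the multiples of d. Each multiple plus d is again a multiple, so s - d
  -- is also an upper bound; hence s ≤ s - d.
  archimedean : ∀ d → (∀ m → fromℕ m * d ≤ 1#) → d ≤ 0#
  archimedean d md≤1 with lub (λ z → ∃[ m ] (z ≈ fromℕ m * d)) (0# * d , 0 , refl)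
                              (1# , λ { z (m , z≈md) → ≤-trans (≤-reflexive z≈md) (md≤1 m) })
  ... | s , s-upper , s-least = begin
      d              ≈⟨ +-identityʳ d ⟨
      d + 0#         ≈⟨ +-congˡ (-‿inverseʳ s) ⟨
      d + (s - s)    ≈⟨ +-assoc d s (- s) ⟨
      d + s - s      ≤⟨ +-mono-≤ (- s) d+s≤s ⟩
      s - s          ≈⟨ -‿inverseʳ s ⟩
      0#             ∎
    where
    open PartialOrderReasoning poset
    s≤s-d : s ≤ s - d
    s≤s-d = s-least (s - d) λ { z (m , z≈md) → begin
      z                        ≈⟨ z≈md ⟩
      fromℕ m * d              ≈⟨ +-identityˡ _ ⟨
      0# + fromℕ m * d         ≈⟨ +-congʳ (-‿inverseʳ d) ⟨
      d - d + fromℕ m * d      ≈⟨ +-assoc _ _ _ ⟩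
      d + (- d + fromℕ m * d)  ≈⟨ +-congˡ (+-comm _ _) ⟩
      d + (fromℕ m * d - d)    ≈⟨ +-assoc _ _ _ ⟨
      d + fromℕ m * d - d      ≈⟨ +-congʳ (+-congʳ (*-identityˡ d)) ⟨
      1# * d + fromℕ m * d - d ≈⟨ +-congʳ (distribʳ d 1# (fromℕ m)) ⟨
      (1# + fromℕ m) * d - d   ≤⟨ +-mono-≤ (- d) (s-upper _ (suc m , refl)) ⟩
      s - d                    ∎ }
    d+s≤s : d + s ≤ s
    d+s≤s = begin
      d + s       ≈⟨ +-comm d s ⟩
      s + d       ≤⟨ +-mono-≤ d s≤s-d ⟩
      s - d + d   ≈⟨ +-assoc _ _ _ ⟩
      s + (- d + d) ≈⟨ +-congˡ (-‿inverseˡ d) ⟩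
      s + 0#      ≈⟨ +-identityʳ s ⟩
      s           ∎

  -- Totality compares each multiple of d with 1. The outcome 1 ≤ m d would refute d ≈ 0, so all
  -- multiples stay below 1 and `archimedean` applies.
  ≤0-stable : ∀ d → ¬ ¬ (d ≈ 0#) → d ≤ 0#
  ≤0-stable d ¬¬d≈0 = archimedean d bound
    where
    bound : ∀ m → fromℕ m * d ≤ 1#
    bound m with total (fromℕ m * d) 1#
    ... | inj₁ md≤1 = md≤1
    ... | inj₂ 1≤md = contradiction (λ d≈0 → 1≰0 (≤-respʳ-≈ (trans (*-congˡ d≈0) (zeroʳ _)) 1≤md)) ¬¬d≈0

  -- This turns the alternative of `weakLEM` into a decision of equality with zero, on which pivot
  -- search and case splits on coefficients rest. Both d and - d are at most 0.
  ≈0-stable : ∀ d → ¬ ¬ (d ≈ 0#) → d ≈ 0#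
  ≈0-stable d ¬¬d≈0 = antisym (≤0-stable d ¬¬d≈0) 0≤d
    where
    -d≤0 : - d ≤ 0#
    -d≤0 = ≤0-stable (- d) λ -d≉0 → ¬¬d≈0 λ d≈0 → -d≉0 (trans (-‿cong d≈0) -0#≈0#)
    0≤d : 0# ≤ d
    0≤d = ≤-respˡ-≈ (-‿inverseˡ d) (≤-respʳ-≈ (+-identityˡ d) (+-mono-≤ d -d≤0))

  infix 4 _≈0?
  _≈0? : ∀ x → Dec (x ≈ 0#)
  x ≈0? with weakLEM (x ≈ 0#)
  ... | inj₁ x≉0   = no x≉0
  ... | inj₂ ¬¬x≈0 = yes (≈0-stable x ¬¬x≈0)

  x*y≈0⇒y≈0 : ∀ {x y} → ¬ x ≈ 0# → x * y ≈ 0# → y ≈ 0#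
  x*y≈0⇒y≈0 {x} {y} x≉0 xy≈0 with inverse x x≉0
  ... | x⁻¹ , xx⁻¹≈1 = begin
      y              ≈⟨ *-identityˡ y ⟨
      1# * y         ≈⟨ *-congʳ (trans (*-comm x⁻¹ x) xx⁻¹≈1) ⟨
      x⁻¹ * x * y    ≈⟨ *-assoc _ _ _ ⟩
      x⁻¹ * (x * y)  ≈⟨ *-congˡ xy≈0 ⟩
      x⁻¹ * 0#       ≈⟨ zeroʳ _ ⟩
      0#             ∎
    where open SetoidReasoning setoid

  x*x≈0⇒x≈0 : ∀ {x} → x * x ≈ 0# → x ≈ 0#
  x*x≈0⇒x≈0 {x} xx≈0 with x ≈0?
  ... | yes x≈0 = x≈0
  ... | no  x≉0 = x*y≈0⇒y≈0 x≉0 xx≈0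

  +-nonneg : ∀ {x y} → 0# ≤ x → 0# ≤ y → 0# ≤ x + y
  +-nonneg {x} {y} 0≤x 0≤y = ≤-trans 0≤y (≤-respˡ-≈ (+-identityˡ y) (+-mono-≤ y 0≤x))

  nonneg-+≈0 : ∀ {x y} → 0# ≤ x → 0# ≤ y → x + y ≈ 0# → x ≈ 0#
  nonneg-+≈0 {x} {y} 0≤x 0≤y x+y≈0 = antisym x≤0 0≤x
    where
    x≤0 : x ≤ 0#
    x≤0 = ≤-respˡ-≈ (+-identityˡ x)
      (≤-respʳ-≈ (trans (+-comm y x) x+y≈0) (+-mono-≤ x 0≤y))

  ∑-nonneg : ∀ m {f : Fin m → Carrier} → (∀ i → 0# ≤ f i) → 0# ≤ ∑ 0# _+_ m f
  ∑-nonneg zero    0≤f = ≤-refl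
  ∑-nonneg (suc m) 0≤f = +-nonneg (0≤f zero) (∑-nonneg m (λ i → 0≤f (suc i)))

  ∑-squares≈0 : ∀ m {f : Fin m → Carrier} → ∑ 0# _+_ m (λ i → f i * f i) ≈ 0# → ∀ i → f i ≈ 0#
  ∑-squares≈0 (suc m) {f} ∑≈0 zero =
    x*x≈0⇒x≈0 (nonneg-+≈0 (square-nonneg _) (∑-nonneg m (λ i → square-nonneg (f (suc i)))) ∑≈0)
  ∑-squares≈0 (suc m) {f} ∑≈0 (suc i) =
    ∑-squares≈0 m (nonneg-+≈0 (∑-nonneg m (λ i → square-nonneg (f (suc i)))) (square-nonneg (f zero))
      (trans (+-comm _ _) ∑≈0)) i

  -- Gaussian elimination: a nonzero coordinate i of the first vector is cleared from all the others.
  dependence : ∀ r (C : Fin (suc r) → Fin r → Carrier) →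
    Σ (Fin (suc r) → Carrier) λ c → (∃[ j ] ¬ c j ≈ 0#) ×
      (∀ i → ∑ 0# _+_ (suc r) (λ j → c j * C j i) ≈ 0#)
  dependence zero C = (λ _ → 1#) , (zero , λ 1≈0 → 0≉1 (sym 1≈0)) , λ ()
  dependence (suc r) C with Fin.any? (λ i → ¬? (C zero i ≈0?))
  ... | no C₀≈0 = e , (zero , λ 1≈0 → 0≉1 (sym 1≈0)) , λ i →
        trans (+-cong (trans (*-identityˡ _) (C₀i≈0 i)) (∑-zero (suc r) (λ j → zeroˡ (C (suc j) i))))
              (+-identityˡ 0#)
    where
    e : Fin (suc (suc r)) → Carrier
    e zero    = 1#
    e (suc _) = 0#
    C₀i≈0 : ∀ i → C zero i ≈ 0#
    C₀i≈0 i with C zero i ≈0?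
    ... | yes p = p
    ... | no ¬p = contradiction (i , ¬p) C₀≈0
  ... | yes (i , p≉0) with inverse (C zero i) p≉0
  ... | p⁻¹ , pp⁻¹≈1 with dependence r
          -- The remaining vectors after subtracting a multiple of the first one; their coordinate i
          -- has become zero and `punchIn i` leaves it out.
          (λ j i′ → C (suc j) (punchIn i i′) - C (suc j) i * p⁻¹ * C zero (punchIn i i′))
  ... | μ , (j , μj≉0) , μ-relation = ν , (suc j , μj≉0) , ν-relation
    where
    open SetoidReasoning setoid
    S : Carrier
    S = ∑ 0# _+_ (suc r) (λ j → μ j * C (suc j) i)
    ν : Fin (suc (suc r)) → Carrier
    -- Coordinate i of the relation forces this coefficient; in the other coordinates it restores
    -- exactly the multiples of the first vector that were subtracted.
    ν zero    = - (S * p⁻¹)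
    ν (suc j) = μ j
    at-pivot : ν zero * C zero i + S ≈ 0#
    at-pivot = begin
      - (S * p⁻¹) * C zero i + S   ≈⟨ +-congʳ (-‿distribˡ-* _ _) ⟨
      - (S * p⁻¹ * C zero i) + S   ≈⟨ +-congʳ (-‿cong (*-assoc _ _ _)) ⟩
      - (S * (p⁻¹ * C zero i)) + S ≈⟨ +-congʳ (-‿cong (*-congˡ (trans (*-comm _ _) pp⁻¹≈1))) ⟩
      - (S * 1#) + S               ≈⟨ +-congʳ (-‿cong (*-identityʳ S)) ⟩
      - S + S                      ≈⟨ -‿inverseˡ S ⟩
      0#                           ∎
    off-pivot : ∀ i′ → let c = punchIn i i′ in
      ν zero * C zero c + ∑ 0# _+_ (suc r) (λ j → μ j * C (suc j) c) ≈ 0#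
    off-pivot i′ = begin
      - (S * p⁻¹) * q + ∑ 0# _+_ (suc r) f
        ≈⟨ +-comm _ _ ⟩
      ∑ 0# _+_ (suc r) f + - (S * p⁻¹) * q
        ≈⟨ +-congˡ (trans (sym (-‿distribˡ-* _ _)) (trans (-‿cong (*-assoc _ _ _)) (-‿distribʳ-* _ _))) ⟩
      ∑ 0# _+_ (suc r) f + S * - (p⁻¹ * q)
        ≈⟨ +-congˡ (∑-*ʳ (suc r) _ (λ j → μ j * C (suc j) i)) ⟩
      ∑ 0# _+_ (suc r) f + ∑ 0# _+_ (suc r) g
        ≈⟨ ∑-+ (suc r) f g ⟨
      ∑ 0# _+_ (suc r) (λ j → f j + g j)
        ≈⟨ ∑-cong (suc r) combine ⟩
      ∑ 0# _+_ (suc r) (λ j → μ j * (C (suc j) c - C (suc j) i * p⁻¹ * q))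
        ≈⟨ μ-relation i′ ⟩
      0# ∎
      where
      c = punchIn i i′
      q = C zero c
      f g : Fin (suc r) → Carrier
      f j = μ j * C (suc j) c
      g j = μ j * C (suc j) i * - (p⁻¹ * q)
      combine : ∀ j → f j + g j ≈ μ j * (C (suc j) c - C (suc j) i * p⁻¹ * q)
      combine j = begin
        f j + g j
          ≈⟨ +-congˡ (*-assoc _ _ _) ⟩
        μ j * C (suc j) c + μ j * (C (suc j) i * - (p⁻¹ * q))
          ≈⟨ distribˡ _ _ _ ⟨
        μ j * (C (suc j) c + C (suc j) i * - (p⁻¹ * q))
          ≈⟨ *-congˡ (+-congˡ (-‿distribʳ-* _ _)) ⟨
        μ j * (C (suc j) c - C (suc j) i * (p⁻¹ * q))
          ≈⟨ *-congˡ (+-congˡ (-‿cong (*-assoc _ _ _))) ⟨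
        μ j * (C (suc j) c - C (suc j) i * p⁻¹ * q) ∎
    ν-relation : ∀ i″ → ν zero * C zero i″ + ∑ 0# _+_ (suc r) (λ j → μ j * C (suc j) i″) ≈ 0#
    ν-relation i″ with i Fin.≟ i″
    ... | yes ≡.refl = at-pivot
    ... | no  i≢i″ = ≡.subst (λ c → ν zero * C zero c + ∑ 0# _+_ (suc r) (λ j → μ j * C (suc j) c) ≈ 0#)
                       (Fin.punchIn-punchOut i≢i″) (off-pivot (punchOut i≢i″))

-- Nonzero sums and maxima of natural numbers.

module NaturalSums where
  open import Data.Nat using (_+_; _≤_)
  open import Data.Nat.Properties
  open import Relation.Binary.PropositionalEquality
    using (refl; sym; trans)

  ∑ℕ≢0⇒∃ : ∀ m {f : Fin m → ℕ} → ∑ℕ m f ≢ 0 → ∃[ i ] f i ≢ 0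
  ∑ℕ≢0⇒∃ zero        ∑≢0 = contradiction refl ∑≢0
  ∑ℕ≢0⇒∃ (suc m) {f} ∑≢0 with f zero in f₀≡
  ... | suc _ = zero , λ f₀≡0 → contradiction (trans (sym f₀≡) f₀≡0) (λ ())
  ... | zero  with ∑ℕ≢0⇒∃ m ∑≢0
  ... | i , fi≢0 = suc i , fi≢0

  ∑ℕ≢0 : ∀ m {f : Fin m → ℕ} i → f i ≢ 0 → ∑ℕ m f ≢ 0
  ∑ℕ≢0 (suc m) {f} zero    fi≢0 ∑≡0 = fi≢0 (m+n≡0⇒m≡0 (f zero) ∑≡0)
  ∑ℕ≢0 (suc m) {f} (suc i) fi≢0 ∑≡0 = ∑ℕ≢0 m i fi≢0 (m+n≡0⇒n≡0 (f zero) ∑≡0)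

  maximiser : ∀ m (f : Fin m → ℕ) → Fin m → ∃[ i ] (∀ j → f j ≤ f i)
  maximiser (suc zero)    f _ = zero , λ { zero → ≤-refl }
  maximiser (suc (suc m)) f _ with maximiser (suc m) (λ i → f (suc i)) zero
  ... | i , fj≤fi with ≤-total (f zero) (f (suc i))
  ... | inj₁ f₀≤fi = suc i , λ { zero → f₀≤fi ; (suc j) → fj≤fi j }
  ... | inj₂ fi≤f₀ = zero , λ { zero → ≤-refl ; (suc j) → ≤-trans (fj≤fi j) fi≤f₀ }

-- Walk counts and adjacency.

module WalkCounts (Γ : Graph) where
  open import Data.Nat using (_+_; _*_; _∸_; _≤_; _<_; ≢-nonZero)
  open import Data.Nat.Properties
  open import Relation.Binary.PropositionalEquality
    using (refl; sym; trans; cong; cong₂; subst; module ≡-Reasoning)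
  open Sums +-*-commutativeSemiring
  open NaturalSums
  open Graph Γ renaming (sym to adj-sym)

  Adj : Fin n → Fin n → Set
  Adj x y = adj x y ≡ true

  Adj-sym : ∀ {x y} → Adj x y → Adj y x
  Adj-sym {x} {y} x~y = trans (adj-sym y x) x~y

  ==-refl : ∀ x → (x == x) ≡ true
  ==-refl x with x Fin.≟ x
  ... | yes _  = refl
  ... | no x≢x = contradiction refl x≢x

  ==⇒≡ : ∀ {x y} → toℕ𝔹 (x == y) ≢ 0 → x ≡ y
  ==⇒≡ {x} {y} x==y with x Fin.≟ y
  ... | yes x≡y = x≡y
  ... | no  _   = contradiction refl x==y

  ≢⇒==0 : ∀ {x y} → x ≢ y → toℕ𝔹 (x == y) ≡ 0
  ≢⇒==0 {x} {y} x≢y with x Fin.≟ y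
  ... | yes x≡y = contradiction x≡y x≢y
  ... | no  _   = refl

  walks-1 : ∀ x y → walks 1 x y ≡ toℕ𝔹 (adj x y)
  walks-1 x y = trans
    (∑-single n _ y λ z z≢y → trans (cong (toℕ𝔹 (adj x z) *_) (≢⇒==0 z≢y)) (*-zeroʳ (toℕ𝔹 (adj x z))))
    (trans (cong (λ b → toℕ𝔹 (adj x y) * toℕ𝔹 b) (==-refl y)) (*-identityʳ _))

  -- `walks` splits off the first step, whereas the argument splits off the last one. Both orders
  -- count the same triples, by exchanging two sums.
  walks-sucʳ : ∀ ℓ x y → walks (suc ℓ) x y ≡ ∑ℕ n (λ z → walks ℓ x z * toℕ𝔹 (adj z y))
  walks-sucʳ zero x y = trans (walks-1 x y) (sym (trans
    (∑-single n _ x λ z z≢x → cong (_* toℕ𝔹 (adj z y)) (≢⇒==0 (λ x≡z → z≢x (sym x≡z))))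
    (trans (cong (λ b → toℕ𝔹 b * toℕ𝔹 (adj x y)) (==-refl x)) (*-identityˡ _))))
  walks-sucʳ (suc ℓ) x y = begin
    ∑ℕ n (λ z → a x z * walks (suc ℓ) z y)
      ≡⟨ ∑-cong n (λ z → cong (a x z *_) (walks-sucʳ ℓ z y)) ⟩
    ∑ℕ n (λ z → a x z * ∑ℕ n (λ w → walks ℓ z w * a w y))
      ≡⟨ ∑-cong n (λ z → ∑-*ˡ n (a x z) _) ⟩
    ∑ℕ n (λ z → ∑ℕ n (λ w → a x z * (walks ℓ z w * a w y)))
      ≡⟨ ∑-swap n n _ ⟩
    ∑ℕ n (λ w → ∑ℕ n (λ z → a x z * (walks ℓ z w * a w y)))
      ≡⟨ ∑-cong n (λ w → ∑-cong n (λ z → sym (*-assoc (a x z) _ _))) ⟩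
    ∑ℕ n (λ w → ∑ℕ n (λ z → a x z * walks ℓ z w * a w y))
      ≡⟨ ∑-cong n (λ w → sym (∑-*ʳ n (a w y) _)) ⟩
    ∑ℕ n (λ w → walks (suc ℓ) x w * a w y) ∎
    where
    open ≡-Reasoning
    a : Fin n → Fin n → ℕ
    a u v = toℕ𝔹 (adj u v)

  walks-sym : ∀ ℓ x y → walks ℓ x y ≡ walks ℓ y x
  walks-sym zero x y with x Fin.≟ y
  ... | yes refl = sym (cong toℕ𝔹 (==-refl x))
  ... | no  x≢y  = sym (≢⇒==0 (λ y≡x → x≢y (sym y≡x)))
  walks-sym (suc ℓ) x y = trans (walks-sucʳ ℓ x y) (∑-cong n λ z →
    trans (*-comm (walks ℓ x z) _) (cong₂ _*_ (cong toℕ𝔹 (adj-sym z y)) (walks-sym ℓ x z)))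

  walks-suc : ∀ ℓ x y → walks (suc ℓ) x y ≡ ∑ℕ n (λ z → toℕ𝔹 (adj y z) * walks ℓ x z)
  walks-suc ℓ x y = trans (walks-sym (suc ℓ) x y)
    (∑-cong n λ z → cong (toℕ𝔹 (adj y z) *_) (walks-sym ℓ z x))

  adj-*≢0 : ∀ b {m} → toℕ𝔹 b * m ≢ 0 → b ≡ true × m ≢ 0
  adj-*≢0 true  {m} m≢0 = refl , λ m≡0 → m≢0 (trans (+-identityʳ m) m≡0)
  adj-*≢0 false     0≢0 = contradiction refl 0≢0

  walks-++ : ∀ {a b x y z} → walks a x y ≢ 0 → walks b y z ≢ 0 → walks (a + b) x z ≢ 0
  walks-++ {zero} {b} {x} {y} {z} x==y w≢0 = subst (λ u → walks b u z ≢ 0) (sym (==⇒≡ x==y)) w≢0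
  walks-++ {suc a} {b} {x} {y} {z} w≢0 w′≢0 with ∑ℕ≢0⇒∃ n w≢0
  ... | u , t≢0 with adj-*≢0 (adj x u) {walks a u y} t≢0
  ... | x~u , wa≢0 = ∑ℕ≢0 n u λ t≡0 → walks-++ {a} {b} {u} {y} {z} wa≢0 w′≢0
          (trans (sym (+-identityʳ _)) (trans (cong (λ c → toℕ𝔹 c * walks (a + b) u z) (sym x~u)) t≡0))

  Adj⇒walks : ∀ {x y} → Adj x y → walks 1 x y ≢ 0
  Adj⇒walks {x} {y} x~y w≡0 = contradiction
    (trans (sym (trans (walks-1 x y) (cong toℕ𝔹 x~y))) w≡0) (λ ())

  -- Distance as the least length of a walk.

  isZero⇒≡0 : ∀ m → isZero m ≡ true → m ≡ 0
  isZero⇒≡0 zero _ = refl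

  ∧-true : ∀ {b c} → b ∧ c ≡ true → b ≡ true × c ≡ true
  ∧-true {true} c≡true = refl , c≡true

  noWalkBelow⇒ : ∀ j {x y} → noWalkBelow j x y ≡ true → ∀ i → i < j → walks i x y ≡ 0
  noWalkBelow⇒ (suc j) {x} {y} none i i<1+j with ∧-true {noWalkBelow j x y} none | m≤n⇒m<n∨m≡n i<1+j
  ... | none′ , _ | inj₁ (s≤s i<j) = noWalkBelow⇒ j none′ i i<j
  ... | _ , zero′ | inj₂ refl      = isZero⇒≡0 _ zero′

  ⇒noWalkBelow : ∀ j {x y} → (∀ i → i < j → walks i x y ≡ 0) → noWalkBelow j x y ≡ true
  ⇒noWalkBelow zero    none = refl
  ⇒noWalkBelow (suc j) none = cong₂ _∧_ (⇒noWalkBelow j (λ i i<j → none i (m<n⇒m<1+n i<j)))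
                                        (cong isZero (none j ≤-refl))

  -- Dist as a record: the Boolean equation Dist unfolds and does not determine x, y and j in unification.
  record HasDist (x y : Fin n) (j : ℕ) : Set where
    constructor hasDist
    field
      noShorter : ∀ i → i < j → walks i x y ≡ 0
      reached   : walks j x y ≢ 0
  open HasDist

  Dist⇒HasDist : ∀ x y j → Dist x y j → HasDist x y j
  Dist⇒HasDist x y j d with ∧-true {noWalkBelow j x y} d
  ... | none , nonzero = hasDist (noWalkBelow⇒ j none)
    λ w≡0 → contradiction (trans (sym nonzero) (cong (λ m → not (isZero m)) w≡0)) (λ ())

  HasDist⇒Dist : ∀ {x y j} → HasDist x y j → Dist x y j
  HasDist⇒Dist {x} {y} {j} (hasDist none w≢0) rewrite ⇒noWalkBelow j {x} {y} none with walks j x y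
  ... | zero  = contradiction refl w≢0
  ... | suc _ = refl

  Dist-≤ : ∀ {j ℓ x y} → HasDist x y j → walks ℓ x y ≢ 0 → j ≤ ℓ
  Dist-≤ {j} {ℓ} d w≢0 = ≮⇒≥ λ ℓ<j → w≢0 (noShorter d ℓ ℓ<j)

  Dist-unique : ∀ {i j x y} → HasDist x y i → HasDist x y j → i ≡ j
  Dist-unique d d′ = ≤-antisym (Dist-≤ d (reached d′)) (Dist-≤ d′ (reached d))

  Dist-triangle : ∀ {a b c x y z} → HasDist x y a → HasDist y z b → HasDist x z c → c ≤ a + b
  Dist-triangle {a} {b} {x = x} {y} {z} dxy dyz dxz =
    Dist-≤ dxz (walks-++ {a} {b} {x} {y} {z} (reached dxy) (reached dyz))

  Dist-sym : ∀ {j x y} → HasDist x y j → HasDist y x j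
  Dist-sym {j} {x} {y} d = hasDist (λ i i<j → trans (walks-sym i y x) (noShorter d i i<j))
                                      (λ w≡0 → reached d (trans (walks-sym j x y) w≡0))

  Dist-refl : ∀ x → HasDist x x 0
  Dist-refl x = hasDist (λ _ ()) λ w≡0 → contradiction (trans (sym (cong toℕ𝔹 (==-refl x))) w≡0) (λ ())

  Dist-0 : ∀ {x y} → HasDist x y 0 → x ≡ y
  Dist-0 d = ==⇒≡ (reached d)

  Dist-1 : ∀ {x y} → HasDist x y 1 → Adj x y
  Dist-1 {x} {y} d = proj₁ (adj-*≢0 (adj x y) {1} λ t≡0 →
    reached d (trans (walks-1 x y) (trans (sym (*-identityʳ _)) t≡0)))

  Adj⇒≢ : ∀ {x y} → Adj x y → x ≢ y
  Adj⇒≢ {x} x~x refl = contradiction (trans (sym x~x) (irrefl x)) (λ ())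

  Adj⇒Dist : ∀ {x y} → Adj x y → HasDist x y 1
  Adj⇒Dist {x} {y} x~y = hasDist (λ { zero _ → ≢⇒==0 (Adj⇒≢ x~y) ; (suc i) (s≤s ()) }) (Adj⇒walks x~y)

  distIs-false : ∀ {x y i} j → HasDist x y i → i ≢ j → distIs x y j ≡ false
  distIs-false {x} {y} j d i≢j with distIs x y j in d′
  ... | true  = contradiction (Dist-unique d (Dist⇒HasDist x y j d′)) i≢j
  ... | false = refl

  -- s-walk-regularity without the condition on the diameter, so that s may grow without bound;
  -- distances that do not occur impose nothing.
  WalkConstant : ℕ → Set
  WalkConstant s = ∀ ℓ j x y x′ y′ → j ≤ s → HasDist x y j → HasDist x′ y′ j → walks ℓ x y ≡ walks ℓ x′ y′

  -- Geodesics.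

  infixr 5 _◂_
  _◂_ : Fin n → (ℕ → Fin n) → ℕ → Fin n
  (z ◂ w) zero    = z
  (z ◂ w) (suc i) = w i

  -- Only the entries 0 to m of the sequence matter. Distances that depend on the difference of the
  -- indices alone are what makes the Gram matrix Toeplitz.
  IsGeodesic : ℕ → (ℕ → Fin n) → Set
  IsGeodesic m w = ∀ i j → i ≤ m → j ≤ m → HasDist (w i) (w j) ∣ i - j ∣

  module _ (connected : ∀ x y → ∃[ j ] HasDist x y j) where

    Dist-≤2 : ∀ {x y z} → Adj x y → Adj y z → HasDist x z 0 ⊎ HasDist x z 1 ⊎ HasDist x z 2
    Dist-≤2 {x} {y} {z} x~y y~z with connected x z
    ... | 0 , d = inj₁ d
    ... | 1 , d = inj₂ (inj₁ d)
    ... | 2 , d = inj₂ (inj₂ d)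
    ... | suc (suc (suc e)) , d
      with Dist-triangle {1} {1} {3 + e} (Adj⇒Dist x~y) (Adj⇒Dist y~z) d
    ... | s≤s (s≤s ())

    predecessor : ∀ {j x y} → HasDist x y (suc j) → ∃[ z ] (Adj y z × HasDist x z j)
    predecessor {j} {x} {y} d
      with ∑ℕ≢0⇒∃ n (λ w≡0 → reached d (trans (walks-suc j x y) w≡0))
    ... | z , t≢0 with adj-*≢0 (adj y z) {walks j x z} t≢0
    ... | y~z , w≢0 with connected x z
    ... | i , d′ = z , y~z , subst (HasDist x z) (≤-antisym (Dist-≤ d′ w≢0) j≤i) d′
      where
      j≤i : j ≤ i
      j≤i = s≤s⁻¹ (subst (suc j ≤_) (+-comm i 1) (Dist-triangle d′ (Adj⇒Dist (Adj-sym y~z)) d))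

    -- The path through w 0 bounds the distance from z to w j above; were it shorter, going on along
    -- w would reach w m in fewer than m + 1 steps.
    geodesic-cons : ∀ {m z w} → IsGeodesic m w → Adj z (w 0) → HasDist z (w m) (suc m) →
                    IsGeodesic (suc m) (z ◂ w)
    geodesic-cons {m} {z} {w} geo z~w₀ d = geo′
      where
      head : ∀ j → j ≤ m → HasDist z (w j) (suc j)
      head j j≤m with connected z (w j)
      ... | e , d′ = subst (HasDist z (w j)) (≤-antisym e≤1+j 1+j≤e) d′
        where
        e≤1+j : e ≤ suc j
        e≤1+j = Dist-triangle (Adj⇒Dist z~w₀) (geo 0 j z≤n j≤m) d′
        1+j≤e : suc j ≤ e
        1+j≤e = +-cancelʳ-≤ (m ∸ j) (suc j) e (begin
          suc j + (m ∸ j) ≡⟨ cong suc (m+[n∸m]≡n j≤m) ⟩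
          suc m           ≤⟨ Dist-triangle d′ (geo j m j≤m ≤-refl) d ⟩
          e + ∣ j - m ∣   ≡⟨ cong (e +_) (m≤n⇒∣m-n∣≡n∸m j≤m) ⟩
          e + (m ∸ j)     ∎)
          where open ≤-Reasoning
      geo′ : IsGeodesic (suc m) (z ◂ w)
      geo′ zero    zero    _         _         = Dist-refl z
      geo′ zero    (suc j) _         (s≤s j≤m) = head j j≤m
      geo′ (suc i) zero    (s≤s i≤m) _         = Dist-sym (head i i≤m)
      geo′ (suc i) (suc j) (s≤s i≤m) (s≤s j≤m) = geo i j i≤m j≤m

    geodesic : ∀ m {x y} → HasDist x y m → ∃[ w ] (w 0 ≡ y × w m ≡ x × IsGeodesic m w)
    geodesic zero {x} {y} d = (λ _ → y) , refl , sym (Dist-0 d) , λ { zero zero _ _ → Dist-refl y }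
    geodesic (suc m) {x} {y} d with predecessor {m} {x} {y} d
    ... | y′ , y~y′ , d′ with geodesic m {x} {y′} d′
    -- The geodesic starts at y and ends at x, so that extending beyond y means putting a vertex in
    -- front.
    ... | w , refl , refl , geo = y ◂ w , refl , refl , geodesic-cons geo y~y′ (Dist-sym d)

    -- Neighbours of y sorted by their distance from x.

    module _ {x y i} (d : HasDist x y (suc i)) where

      Dist-neighbour : ∀ {z} → Adj y z → HasDist x z i ⊎ HasDist x z (suc i) ⊎ HasDist x z (2 + i)
      Dist-neighbour {z} y~z with connected x z
      ... | e , d′ with m≤n⇒m<n∨m≡n i≤e
        where
        i≤e : i ≤ e
        i≤e = s≤s⁻¹ (subst (suc i ≤_) (+-comm e 1) (Dist-triangle d′ (Adj⇒Dist (Adj-sym y~z)) d))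
      ... | inj₂ refl = inj₁ d′
      ... | inj₁ 1+i≤e with m≤n⇒m<n∨m≡n 1+i≤e
      ... | inj₂ refl = inj₂ (inj₁ d′)
      ... | inj₁ 2+i≤e = inj₂ (inj₂ (subst (HasDist x z) (≤-antisym e≤2+i 2+i≤e) d′))
        where
        e≤2+i : e ≤ 2 + i
        e≤2+i = subst (e ≤_) (+-comm (suc i) 1) (Dist-triangle d (Adj⇒Dist y~z) d′)

      -- By `Dist-neighbour` only three distances occur. The outermost one keeps the individual
      -- values of g, about which nothing is assumed.
      neighbour-sum : ∀ (g : Fin n → ℕ) {A B} →
        (∀ z → HasDist x z i → g z ≡ A) → (∀ z → HasDist x z (suc i) → g z ≡ B) →
        ∑ℕ n (λ z → toℕ𝔹 (adj y z) * g z) ≡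
        nbAt x y i * A + nbAt x y (suc i) * B + ∑ℕ n (λ z → toℕ𝔹 (adj y z ∧ distIs x z (2 + i)) * g z)
      neighbour-sum g {A} {B} gA gB = begin
        ∑ℕ n (λ z → toℕ𝔹 (adj y z) * g z)
          ≡⟨ ∑-cong n split ⟩
        ∑ℕ n (λ z → N i z * A + N (suc i) z * B + N (2 + i) z * g z)
          ≡⟨ ∑-+ n _ _ ⟩
        ∑ℕ n (λ z → N i z * A + N (suc i) z * B) + ∑ℕ n (λ z → N (2 + i) z * g z)
          ≡⟨ cong (_+ ∑ℕ n (λ z → N (2 + i) z * g z)) (∑-+ n _ _) ⟩
        ∑ℕ n (λ z → N i z * A) + ∑ℕ n (λ z → N (suc i) z * B) + ∑ℕ n (λ z → N (2 + i) z * g z)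
          ≡⟨ cong₂ (λ p q → p + q + ∑ℕ n (λ z → N (2 + i) z * g z)) (∑-*ʳ n A _) (∑-*ʳ n B _) ⟨
        nbAt x y i * A + nbAt x y (suc i) * B + ∑ℕ n (λ z → N (2 + i) z * g z) ∎
        where
        open ≡-Reasoning
        N : ℕ → Fin n → ℕ
        N j z = toℕ𝔹 (adj y z ∧ distIs x z j)
        split : ∀ z → toℕ𝔹 (adj y z) * g z ≡ N i z * A + N (suc i) z * B + N (2 + i) z * g z
        split z with adj y z in y~z
        ... | false = refl
        ... | true with Dist-neighbour y~z
        ... | inj₁ d₀
          rewrite HasDist⇒Dist d₀ | distIs-false {x} {z} (suc i) d₀ (λ ()) | distIs-false {x} {z} (2 + i) d₀ (λ ()) | gA z d₀ =
              sym (trans (+-identityʳ _) (+-identityʳ _))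
        ... | inj₂ (inj₁ d₁)
          rewrite HasDist⇒Dist d₁ | distIs-false {x} {z} i d₁ (λ ()) | distIs-false {x} {z} (2 + i) d₁ (λ ()) | gB z d₁ =
              sym (+-identityʳ _)
        ... | inj₂ (inj₂ d₂)
          rewrite HasDist⇒Dist d₂ | distIs-false {x} {z} i d₂ (λ ()) | distIs-false {x} {z} (suc i) d₂ (λ ()) = refl

      nbAt-sum : degree y ≡ nbAt x y i + nbAt x y (suc i) + nbAt x y (2 + i)
      nbAt-sum = begin
        ∑ℕ n (λ z → toℕ𝔹 (adj y z))
          ≡⟨ ∑-cong n (λ z → sym (*-identityʳ _)) ⟩
        ∑ℕ n (λ z → toℕ𝔹 (adj y z) * 1)
          ≡⟨ neighbour-sum (λ _ → 1) (λ _ _ → refl) (λ _ _ → refl) ⟩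
        nbAt x y i * 1 + nbAt x y (suc i) * 1 + ∑ℕ n (λ z → toℕ𝔹 (adj y z ∧ distIs x z (2 + i)) * 1)
          ≡⟨ cong₂ _+_ (cong₂ _+_ (*-identityʳ (nbAt x y i)) (*-identityʳ (nbAt x y (suc i)))) (∑-cong n (λ z → *-identityʳ _)) ⟩
        nbAt x y i + nbAt x y (suc i) + nbAt x y (2 + i) ∎
        where open ≡-Reasoning

      outer-sum≡0 : ∀ ℓ → ℓ < 2 + i →
        ∑ℕ n (λ z → toℕ𝔹 (adj y z ∧ distIs x z (2 + i)) * walks ℓ x z) ≡ 0
      outer-sum≡0 ℓ ℓ<2+i = ∑-zero n term
        where
        term : ∀ z → toℕ𝔹 (adj y z ∧ distIs x z (2 + i)) * walks ℓ x z ≡ 0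
        term z with adj y z | distIs x z (2 + i) in d₂
        ... | false | _     = refl
        ... | true  | false = refl
        ... | true  | true  = trans (+-identityʳ _) (noShorter (Dist⇒HasDist x z (2 + i) d₂) ℓ ℓ<2+i)

      outer-sum-single : ∀ ℓ {y⁺} → Adj y y⁺ → HasDist x y⁺ (2 + i) →
        (∀ z → Adj y z → HasDist x z (2 + i) → z ≡ y⁺) →
        ∑ℕ n (λ z → toℕ𝔹 (adj y z ∧ distIs x z (2 + i)) * walks ℓ x z) ≡ walks ℓ x y⁺
      outer-sum-single ℓ {y⁺} y~y⁺ d⁺ unique = trans (∑-single n _ y⁺ term)
        (trans (cong₂ (λ b c → toℕ𝔹 (b ∧ c) * walks ℓ x y⁺) y~y⁺ (HasDist⇒Dist d⁺)) (+-identityʳ _))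
        where
        term : ∀ z → z ≢ y⁺ → toℕ𝔹 (adj y z ∧ distIs x z (2 + i)) * walks ℓ x z ≡ 0
        term z z≢y⁺ with adj y z in y~z | distIs x z (2 + i) in d₂
        ... | false | _     = refl
        ... | true  | false = refl
        ... | true  | true  = contradiction (unique z y~z (Dist⇒HasDist x z (2 + i) d₂)) z≢y⁺

    -- Intersection numbers and outer walk counts from constant walk counts.

    module _ {s} (walk-constant : WalkConstant s)
             {x y x′ y′ i} (1+i≤s : suc i ≤ s) (d : HasDist x y (suc i)) (d′ : HasDist x′ y′ (suc i)) where

      private
        z₀ : Fin n
        z₀ = proj₁ (predecessor d)
        d₀ : HasDist x z₀ i
        d₀ = proj₂ (proj₂ (predecessor d))
        i≤s : i ≤ s
        i≤s = ≤-trans (n≤1+n i) 1+i≤s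

        -- By constancy the pairs (x, z₀) and (x, y) supply the walk counts for every (u, v), so two
        -- such pairs can differ only in their `nbAt` factors and outer sums.
        walks-split : ∀ ℓ {u v} (duv : HasDist u v (suc i)) → walks (suc ℓ) u v ≡
          nbAt u v i * walks ℓ x z₀ + nbAt u v (suc i) * walks ℓ x y +
          ∑ℕ n (λ z → toℕ𝔹 (adj v z ∧ distIs u z (2 + i)) * walks ℓ u z)
        walks-split ℓ {u} {v} duv = trans (walks-suc ℓ u v) (neighbour-sum duv (walks ℓ u)
          (λ z dz → walk-constant ℓ i u z x z₀ i≤s dz d₀)
          (λ z dz → walk-constant ℓ (suc i) u z x y 1+i≤s dz d))

        inner : ∀ {u v} → HasDist u v (suc i) → walks (suc i) u v ≡ nbAt u v i * walks i x z₀
        inner {u} {v} duv = begin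
          walks (suc i) u v
            ≡⟨ walks-split i duv ⟩
          nbAt u v i * walks i x z₀ + nbAt u v (suc i) * walks i x y + _
            ≡⟨ cong₂ (λ p q → nbAt u v i * walks i x z₀ + nbAt u v (suc i) * p + q)
                 (noShorter d i ≤-refl) (outer-sum≡0 duv i (n≤1+n (suc i))) ⟩
          nbAt u v i * walks i x z₀ + nbAt u v (suc i) * 0 + 0
            ≡⟨ trans (+-identityʳ _) (trans (cong (nbAt u v i * walks i x z₀ +_) (*-zeroʳ (nbAt u v (suc i)))) (+-identityʳ _)) ⟩
          nbAt u v i * walks i x z₀ ∎
          where open ≡-Reasoning

      -- A walk of length i + 1 to distance i + 1 takes its last step from distance i. The factor
      -- `walks i x z₀` is nonzero because z₀ is at distance i.
      nbAt-inner : nbAt x y i ≡ nbAt x′ y′ i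
      nbAt-inner = *-cancelʳ-≡ _ _ (walks i x z₀) {{≢-nonZero (reached d₀)}}
        (trans (sym (inner d)) (trans (walk-constant (suc i) (suc i) x y x′ y′ 1+i≤s d d′) (inner d′)))

      -- Walks of length i + 2 are compared: i + 1 steps do not reach distance i + 2, so the outer
      -- sum still vanishes, and the inner term is known already.
      nbAt-level : nbAt x y (suc i) ≡ nbAt x′ y′ (suc i)
      nbAt-level = *-cancelʳ-≡ _ _ (walks (suc i) x y) {{≢-nonZero (reached d)}}
        (+-cancelˡ-≡ (nbAt x y i * walks (suc i) x z₀) _ _ (begin
          nbAt x y i * walks (suc i) x z₀ + nbAt x y (suc i) * walks (suc i) x y
            ≡⟨ level d ⟨
          walks (2 + i) x y
            ≡⟨ walk-constant (2 + i) (suc i) x y x′ y′ 1+i≤s d d′ ⟩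
          walks (2 + i) x′ y′
            ≡⟨ level d′ ⟩
          nbAt x′ y′ i * walks (suc i) x z₀ + nbAt x′ y′ (suc i) * walks (suc i) x y
            ≡⟨ cong (λ c → c * walks (suc i) x z₀ + nbAt x′ y′ (suc i) * walks (suc i) x y) nbAt-inner ⟨
          nbAt x y i * walks (suc i) x z₀ + nbAt x′ y′ (suc i) * walks (suc i) x y ∎))
        where
        open ≡-Reasoning
        level : ∀ {u v} → HasDist u v (suc i) → walks (2 + i) u v ≡
                nbAt u v i * walks (suc i) x z₀ + nbAt u v (suc i) * walks (suc i) x y
        level {u} {v} duv = trans (walks-split (suc i) duv)
          (trans (cong (nbAt u v i * walks (suc i) x z₀ + nbAt u v (suc i) * walks (suc i) x y +_)
                       (outer-sum≡0 duv (suc i) ≤-refl))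
                 (+-identityʳ _))

      nbAt-outer : degree y ≡ degree y′ → nbAt x y (2 + i) ≡ nbAt x′ y′ (2 + i)
      nbAt-outer deg≡ = +-cancelˡ-≡ (nbAt x y i + nbAt x y (suc i)) _ _
        (trans (sym (nbAt-sum d)) (trans deg≡ (trans (nbAt-sum d′)
          (cong (_+ nbAt x′ y′ (2 + i)) (sym (cong₂ _+_ nbAt-inner nbAt-level))))))

      -- Among the walks of length ℓ + 1 from x to y, those whose last step comes from distance i +
      -- 2 come through y⁺ alone; all other terms agree for the two pairs and cancel.
      walks-outer : ∀ ℓ {y⁺ y′⁺} → Adj y y⁺ → HasDist x y⁺ (2 + i) → Adj y′ y′⁺ → HasDist x′ y′⁺ (2 + i) →
        (∀ z → Adj y z → HasDist x z (2 + i) → z ≡ y⁺) →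
        (∀ z → Adj y′ z → HasDist x′ z (2 + i) → z ≡ y′⁺) →
        walks ℓ x y⁺ ≡ walks ℓ x′ y′⁺
      walks-outer ℓ {y⁺} {y′⁺} y~ d⁺ y′~ d′⁺ unique unique′ =
        +-cancelˡ-≡ (nbAt x y i * walks ℓ x z₀ + nbAt x y (suc i) * walks ℓ x y) _ _ (begin
          nbAt x y i * walks ℓ x z₀ + nbAt x y (suc i) * walks ℓ x y + walks ℓ x y⁺
            ≡⟨ cong (nbAt x y i * walks ℓ x z₀ + nbAt x y (suc i) * walks ℓ x y +_)
                 (outer-sum-single d ℓ y~ d⁺ unique) ⟨
          _ ≡⟨ walks-split ℓ d ⟨
          walks (suc ℓ) x y
            ≡⟨ walk-constant (suc ℓ) (suc i) x y x′ y′ 1+i≤s d d′ ⟩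
          walks (suc ℓ) x′ y′
            ≡⟨ walks-split ℓ d′ ⟩
          _ ≡⟨ cong₂ _+_ (cong₂ (λ p q → p * walks ℓ x z₀ + q * walks ℓ x y) (sym nbAt-inner) (sym nbAt-level))
                 (outer-sum-single d′ ℓ y′~ d′⁺ unique′) ⟩
          nbAt x y i * walks ℓ x z₀ + nbAt x y (suc i) * walks ℓ x y + walks ℓ x′ y′⁺ ∎)
        where open ≡-Reasoning

    -- Walk-regularity carried outward one distance at a time.

    UniqueExtension : ℕ → Set
    UniqueExtension m = ∀ {x y z z′} → HasDist x y m → Adj y z → Adj y z′ →
                        HasDist x z (suc m) → HasDist x z′ (suc m) → z ≡ z′

    -- For a vertex y at the new distance 2 + i, take a predecessor u. Uniqueness makes y the only
    -- outer neighbour of u, so `walks-outer` applies at u.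
    WalkConstant-suc : ∀ {i} → UniqueExtension (suc i) → WalkConstant (suc i) → WalkConstant (2 + i)
    WalkConstant-suc {i} unique wc ℓ j x y x′ y′ j≤2+i d d′ with m≤n⇒m<n∨m≡n j≤2+i
    ... | inj₁ (s≤s j≤1+i) = wc ℓ j x y x′ y′ j≤1+i d d′
    ... | inj₂ refl with predecessor {suc i} {x} {y} d | predecessor {suc i} {x′} {y′} d′
    ... | u , y~u , du | u′ , y′~u′ , du′ =
          walks-outer wc ≤-refl du du′ ℓ (Adj-sym y~u) d (Adj-sym y′~u′) d′
            (λ z u~z dz → unique du u~z (Adj-sym y~u) dz d)
            (λ z u~z dz → unique du′ u~z (Adj-sym y′~u′) dz d′)

    WalkConstant-+ : ∀ {i} → (∀ m → suc i ≤ m → UniqueExtension m) → WalkConstant (suc i) →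
                     ∀ e → WalkConstant (e + suc i)
    WalkConstant-+ {i} unique wc zero    = wc
    WalkConstant-+ {i} unique wc (suc e) = subst WalkConstant (cong suc (sym (+-suc e i)))
      (WalkConstant-suc (unique (suc (e + i)) (s≤s (m≤n+m i e)))
        (subst WalkConstant (+-suc e i) (WalkConstant-+ unique wc e)))

    -- Diameter and distance-regularity.

    diameter : Fin n → ∃[ D ] IsDiameter D
    diameter v = dist x₀ (far x₀) ,
      (λ x y → dist x y , ≤-trans (proj₂ (maximiser n (dist x) x) y) (x₀-max x) , dist-is x y) ,
      x₀ , far x₀ , dist-is x₀ (far x₀)
      where
      dist : Fin n → Fin n → ℕ
      dist x y = proj₁ (connected x y)
      dist-is : ∀ x y → Dist x y (dist x y)
      dist-is x y = HasDist⇒Dist (proj₂ (connected x y))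
      far : Fin n → Fin n
      far x = proj₁ (maximiser n (dist x) x)
      x₀ : Fin n
      -- The distance is maximised over the far end first and then over the start; v only witnesses
      -- that there is a vertex.
      x₀ = proj₁ (maximiser n (λ x → dist x (far x)) v)
      x₀-max : ∀ x → dist x (far x) ≤ dist x₀ (far x₀)
      x₀-max = proj₂ (maximiser n (λ x → dist x (far x)) v)

    distanceRegular : ∀ {k} → Regular k → Fin n → (∀ s → WalkConstant s) → DistanceRegular
    distanceRegular {k} regular v wc with diameter v
    ... | D , isDiameter = D , isDiameter , λ j x y x′ y′ j≤D d d′ →
      numbers j x y x′ y′ (Dist⇒HasDist x y j d) (Dist⇒HasDist x′ y′ j d′)
      where
      nbAt-00 : ∀ x → nbAt x x 0 ≡ 0
      nbAt-00 x = ∑-zero n term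
        where
        term : ∀ z → toℕ𝔹 (adj x z ∧ distIs x z 0) ≡ 0
        term z with adj x z in x~z
        ... | false = refl
        ... | true rewrite distIs-false {x} {z} {1} 0 (Adj⇒Dist x~z) (λ ()) = refl
      nbAt-01 : ∀ x → nbAt x x 1 ≡ k
      nbAt-01 x = trans (∑-cong n term) (regular x)
        where
        term : ∀ z → toℕ𝔹 (adj x z ∧ distIs x z 1) ≡ toℕ𝔹 (adj x z)
        term z with adj x z in x~z
        ... | false = refl
        ... | true  = cong toℕ𝔹 (HasDist⇒Dist (Adj⇒Dist x~z))
      numbers : ∀ j x y x′ y′ → HasDist x y j → HasDist x′ y′ j →
          (∀ i → j ≡ suc i → nbAt x y i ≡ nbAt x′ y′ i)
        × (nbAt x y j ≡ nbAt x′ y′ j)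
        × (nbAt x y (suc j) ≡ nbAt x′ y′ (suc j))
      -- Distance 0 has no predecessor, so its numbers are read off directly as 0 and k.
      numbers zero x y x′ y′ d d′ with Dist-0 {x} {y} d | Dist-0 {x′} {y′} d′
      ... | refl | refl = (λ _ ()) , trans (nbAt-00 x) (sym (nbAt-00 x′)) , trans (nbAt-01 x) (sym (nbAt-01 x′))
      numbers (suc i) x y x′ y′ d d′ =
        (λ { _ refl → nbAt-inner (wc (suc i)) ≤-refl d d′ }) ,
        nbAt-level (wc (suc i)) ≤-refl d d′ ,
        nbAt-outer (wc (suc i)) ≤-refl d d′ (trans (regular y) (sym (regular y′)))

-- The idempotent as a Gram matrix of real vectors.

module Representation (ℝ : Reals) (Γ : Graph) where
  open Reals ℝ using (fromℕ)
  open RealField ℝ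
  open Graph Γ using (n; adj; toℕ𝔹; degree; Regular)
  open WalkCounts Γ
  open SetoidReasoning setoid

  fromℕ-+ : ∀ a b → fromℕ (a ℕ.+ b) ≈ fromℕ a + fromℕ b
  fromℕ-+ zero    b = sym (+-identityˡ _)
  fromℕ-+ (suc a) b = trans (+-congˡ (fromℕ-+ a b)) (sym (+-assoc _ _ _))

  fromℕ-∑ : ∀ m (f : Fin m → ℕ) → fromℕ (∑ℕ m f) ≈ ∑ 0# _+_ m (λ i → fromℕ (f i))
  fromℕ-∑ zero    f = refl
  fromℕ-∑ (suc m) f = trans (fromℕ-+ (f zero) _) (+-congˡ (fromℕ-∑ m (λ i → f (suc i))))

  x-y≈0⇒x≈y : ∀ {x y} → x - y ≈ 0# → x ≈ y
  x-y≈0⇒x≈y = x∙y⁻¹≈ε⇒x≈y _ _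

  *-cancelˡ : ∀ {a x y} → ¬ a ≈ 0# → a * x ≈ a * y → x ≈ y
  *-cancelˡ {a} {x} {y} a≉0 ax≈ay = x-y≈0⇒x≈y (x*y≈0⇒y≈0 a≉0 (begin
    a * (x - y)     ≈⟨ distribˡ a x (- y) ⟩
    a * x + a * - y ≈⟨ +-cong ax≈ay (sym (-‿distribʳ-* a y)) ⟩
    a * y - a * y   ≈⟨ -‿inverseʳ _ ⟩
    0#              ∎))

  adj-sum : ∀ {x} {M : Mat ℝ Γ} {y c} → (∀ z → Adj x z → M z y ≈ c) →
            _·_ ℝ Γ (Aℝ ℝ Γ) M x y ≈ fromℕ (degree x) * c
  adj-sum {x} {M} {y} {c} M≈c = begin
    ∑ 0# _+_ n (λ z → Aℝ ℝ Γ x z * M z y)             ≈⟨ ∑-cong n term ⟩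
    ∑ 0# _+_ n (λ z → fromℕ (toℕ𝔹 (adj x z)) * c)     ≈⟨ ∑-*ʳ n c _ ⟨
    ∑ 0# _+_ n (λ z → fromℕ (toℕ𝔹 (adj x z))) * c     ≈⟨ *-congʳ (fromℕ-∑ n _) ⟨
    fromℕ (degree x) * c                              ∎
    where
    term : ∀ z → Aℝ ℝ Γ x z * M z y ≈ fromℕ (toℕ𝔹 (adj x z)) * c
    term z with adj x z in x~z
    ... | false = trans (zeroˡ _) (sym (zeroˡ _))
    ... | true  = *-cong (sym (+-identityʳ 1#)) (M≈c z x~z)

  module _ {E : Mat ℝ Γ} (E-sym : ∀ x y → E x y ≈ E y x)
           (E-idem : ∀ x y → _·_ ℝ Γ E E x y ≈ E x y) where

    -- E is a Gram matrix: a combination of its rows with zero Gram norm vanishes.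
    combination-null : ∀ m (c : Fin m → Carrier) (w : Fin m → Fin n) →
      (∀ j → ∑ 0# _+_ m (λ i → c i * E (w i) (w j)) ≈ 0#) →
      ∀ v → ∑ 0# _+_ m (λ i → c i * E (w i) v) ≈ 0#
    -- With f the combination, f E = f by idempotence. Hence the squared norm of f is the sum of the
    -- c j times f (w j), and each f (w j) is zero by `gram`.
    combination-null m c w gram = ∑-squares≈0 n (begin
      ∑ 0# _+_ n (λ v → f v * f v)
        ≈⟨ ∑-cong n (λ v → ∑-*ˡ m (f v) _) ⟩
      ∑ 0# _+_ n (λ v → ∑ 0# _+_ m (λ j → f v * (c j * E (w j) v)))
        ≈⟨ ∑-swap n m _ ⟩
      ∑ 0# _+_ m (λ j → ∑ 0# _+_ n (λ v → f v * (c j * E (w j) v)))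
        ≈⟨ ∑-cong m (λ j → ∑-cong n (λ v → trans (trans (sym (*-assoc _ _ _)) (*-congʳ (*-comm _ _)))
             (trans (*-assoc _ _ _) (*-congˡ (*-congˡ (E-sym (w j) v)))))) ⟩
      ∑ 0# _+_ m (λ j → ∑ 0# _+_ n (λ v → c j * (f v * E v (w j))))
        ≈⟨ ∑-cong m (λ j → sym (∑-*ˡ n (c j) _)) ⟩
      ∑ 0# _+_ m (λ j → c j * ∑ 0# _+_ n (λ v → f v * E v (w j)))
        ≈⟨ ∑-zero m (λ j → trans (*-congˡ (trans (fE≈f (w j)) (gram j))) (zeroʳ (c j))) ⟩
      0# ∎)
      where
      f : Fin n → Carrier
      f v = ∑ 0# _+_ m (λ i → c i * E (w i) v)
      fE≈f : ∀ y → ∑ 0# _+_ n (λ v → f v * E v y) ≈ f y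
      fE≈f y = begin
        ∑ 0# _+_ n (λ v → f v * E v y)
          ≈⟨ ∑-cong n (λ v → ∑-*ʳ m (E v y) _) ⟩
        ∑ 0# _+_ n (λ v → ∑ 0# _+_ m (λ i → c i * E (w i) v * E v y))
          ≈⟨ ∑-swap n m _ ⟩
        ∑ 0# _+_ m (λ i → ∑ 0# _+_ n (λ v → c i * E (w i) v * E v y))
          ≈⟨ ∑-cong m (λ i → trans (∑-cong n (λ v → *-assoc _ _ _)) (sym (∑-*ˡ n (c i) _))) ⟩
        ∑ 0# _+_ m (λ i → c i * _·_ ℝ Γ E E (w i) y)
          ≈⟨ ∑-cong m (λ i → *-congˡ (E-idem (w i) y)) ⟩
        f y ∎

    -- Toeplitz relations along geodesics.

    module _ {t} {α : ℕ → Carrier} (E≈α : ∀ {j x y} → j ℕ.≤ t → HasDist x y j → E x y ≈ α j) where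

      -- The difference of the two rows has inner products ±(α 0 - α j) with each of them, hence
      -- zero norm.
      same-row : ∀ {j x y} → j ℕ.≤ t → HasDist x y j → α j ≈ α 0 → ∀ v → E x v ≈ E y v
      same-row {j} {x} {y} j≤t d αj≈α0 v = x-y≈0⇒x≈y
        (trans (sym (difference (E x v) (E y v))) (combination-null 2 c w gram v))
        where
        c : Fin 2 → Carrier
        c zero    = 1#
        c (suc _) = - 1#
        w : Fin 2 → Fin n
        w zero    = x
        w (suc _) = y
        difference : ∀ a b → 1# * a + (- 1# * b + 0#) ≈ a - b
        difference a b = +-cong (*-identityˡ a) (trans (+-identityʳ _) (-1*x≈-x b))
        gram : ∀ i → 1# * E x (w i) + (- 1# * E y (w i) + 0#) ≈ 0#
        gram zero = trans (difference _ _) (trans (+-cong (E≈α z≤n (Dist-refl x))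
          (-‿cong (trans (E≈α j≤t (Dist-sym d)) αj≈α0))) (-‿inverseʳ (α 0)))
        gram (suc zero) = trans (difference _ _) (trans (+-cong (trans (E≈α j≤t d) αj≈α0)
          (-‿cong (E≈α z≤n (Dist-refl y)))) (-‿inverseʳ (α 0)))

      toeplitz-gram : ∀ {r M} {w : ℕ → Fin n} → r ℕ.≤ suc t → t ℕ.≤ M → IsGeodesic M w →
        ∀ i (j : Fin r) → E (w (toℕ {r} i)) (w (toℕ j)) ≈ α ∣ toℕ i - toℕ j ∣
      toeplitz-gram {r} r≤1+t t≤M geo i j = E≈α
        (ℕ.≤-trans (ℕ.∣m-n∣≤m⊔n (toℕ i) (toℕ j)) (ℕ.⊔-lub (≤t i) (≤t j)))
        (geo (toℕ i) (toℕ j) (ℕ.≤-trans (≤t i) t≤M) (ℕ.≤-trans (≤t j) t≤M))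
        where
        ≤t : (i : Fin r) → toℕ i ℕ.≤ t
        ≤t i = s≤s⁻¹ (ℕ.≤-trans (Fin.toℕ<n i) r≤1+t)

      -- Leading zero coefficients are peeled off, which keeps the relation Toeplitz.
      branches-agree : ∀ {M z z′} {w : ℕ → Fin n} → t ℕ.≤ M →
        IsGeodesic M (z ◂ w) → IsGeodesic M (z′ ◂ w) →
        ∀ r → r ℕ.≤ suc t → (c : Fin r → Carrier) → (∃[ i ] ¬ c i ≈ 0#) →
        (∀ j → ∑ 0# _+_ r (λ i → c i * α ∣ toℕ i - toℕ {r} j ∣) ≈ 0#) →
        ∀ v → E z v ≈ E z′ v
      branches-agree {M} {z} {z′} {w} t≤M geo geo′ (suc r) r≤1+t c nonzero toeplitz v with c zero ≈0?
      -- The two relations differ only in the row of the head, so its nonzero coefficient can be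
      -- cancelled.
      ... | no c₀≉0 = *-cancelˡ c₀≉0 (+-cancelʳ (∑ 0# _+_ r (λ i → c (suc i) * E (w (toℕ i)) v)) _ _
              (trans (row geo) (sym (row geo′))))
        where
        row : ∀ {u} → IsGeodesic M (u ◂ w) →
              c zero * E u v + ∑ 0# _+_ r (λ i → c (suc i) * E (w (toℕ i)) v) ≈ 0#
        row {u} g = combination-null (suc r) c (λ i → (u ◂ w) (toℕ i))
          (λ j → trans (∑-cong (suc r) (λ i → *-congˡ {c i} (toeplitz-gram r≤1+t t≤M g i j))) (toeplitz j)) v
      -- The equations with index `suc j` form a Toeplitz relation of size r. Since it involves only
      -- α, it is applied afresh from the heads z and z′ of the same geodesics.
      ... | yes c₀≈0 = branches-agree t≤M geo geo′ r (ℕ.≤-trans (ℕ.n≤1+n r) r≤1+t)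
              (λ i → c (suc i)) (tail-nonzero nonzero) tail-toeplitz v
        where
        tail-nonzero : (∃[ i ] ¬ c i ≈ 0#) → ∃[ i ] ¬ c (suc i) ≈ 0#
        tail-nonzero (zero  , c₀≉0) = contradiction c₀≈0 c₀≉0
        tail-nonzero (suc i , ci≉0) = i , ci≉0
        tail-toeplitz : ∀ j → ∑ 0# _+_ r (λ i → c (suc i) * α ∣ toℕ i - toℕ {r} j ∣) ≈ 0#
        tail-toeplitz j = trans (sym (trans (+-congʳ (trans (*-congʳ c₀≈0) (zeroˡ _))) (+-identityˡ _)))
                                (toeplitz (suc j))

      -- The columns of the vertices w 0, ..., w t have coordinate vectors of length t, and t + 1 of
      -- those are dependent. Written in α alone, the relation passes to any other geodesic of
      -- length at least t.
      rank-relation : RankAtMost ℝ Γ t E → ∀ {M w} → t ℕ.≤ M → IsGeodesic M w →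
        Σ (Fin (suc t) → Carrier) λ c → (∃[ i ] ¬ c i ≈ 0#) ×
          (∀ j → ∑ 0# _+_ (suc t) (λ i → c i * α ∣ toℕ i - toℕ {suc t} j ∣) ≈ 0#)
      rank-relation (v , span) {M} {w} t≤M geo with dependence t (λ j → proj₁ (span (w (toℕ j))))
      ... | c , nonzero , relation = c , nonzero , λ j → begin
          ∑ 0# _+_ (suc t) (λ i → c i * α ∣ toℕ i - toℕ j ∣)
            ≈⟨ ∑-cong (suc t) (λ i → *-congˡ {c i} (trans (sym (toeplitz-gram ℕ.≤-refl t≤M geo i j))
                 (trans (E-sym _ _) (proj₂ (span (w (toℕ i))) _)))) ⟩
          ∑ 0# _+_ (suc t) (λ i → c i * ∑ 0# _+_ t (λ l → b i l * v l (w (toℕ j))))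
            ≈⟨ ∑-cong (suc t) (λ i → trans (∑-*ˡ t (c i) _) (∑-cong t (λ l → sym (*-assoc (c i) (b i l) (v l (w (toℕ j))))))) ⟩
          ∑ 0# _+_ (suc t) (λ i → ∑ 0# _+_ t (λ l → c i * b i l * v l (w (toℕ j))))
            ≈⟨ ∑-swap (suc t) t (λ i l → c i * b i l * v l (w (toℕ j))) ⟩
          ∑ 0# _+_ t (λ l → ∑ 0# _+_ (suc t) (λ i → c i * b i l * v l (w (toℕ j))))
            ≈⟨ ∑-cong t (λ l → sym (∑-*ʳ (suc t) (v l (w (toℕ j))) (λ i → c i * b i l))) ⟩
          ∑ 0# _+_ t (λ l → ∑ 0# _+_ (suc t) (λ i → c i * b i l) * v l (w (toℕ j)))
            ≈⟨ ∑-zero t (λ l → trans (*-congʳ (relation l)) (zeroˡ _)) ⟩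
          0# ∎
        where
        b : Fin (suc t) → Fin t → Carrier
        b i = proj₁ (span (w (toℕ i)))

      -- Coincidence of nearby rows excluded by the eigenvalue.

      module _ {k} (regular : Regular k) {θ} (eigen : ∀ x y → _·_ ℝ Γ (Aℝ ℝ Γ) E x y ≈ θ * E x y)
               (2≤t : 2 ℕ.≤ t) (nonzero : ∃[ x ] ∃[ y ] ¬ E x y ≈ 0#) where

        private
          1≤t : 1 ℕ.≤ t
          1≤t = ℕ.≤-trans (s≤s z≤n) 2≤t

        eigen-constant : ∀ {x y c} → (∀ z → Adj x z → E z y ≈ c) → θ * E x y ≈ fromℕ k * c
        eigen-constant {x} {y} {c} E≈c = trans (sym (eigen x y))
          (≡.subst (λ m → _·_ ℝ Γ (Aℝ ℝ Γ) E x y ≈ fromℕ m * c) (regular x) (adj-sum {M = E} E≈c))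

        -- α 0 is the squared norm of every row, and some row is nonzero.
        α₀≉0 : ¬ α 0 ≈ 0#
        α₀≉0 α₀≈0 = proj₂ (proj₂ nonzero) (trans (sym (trans (+-identityʳ _) (*-identityˡ _)))
          (combination-null 1 (λ _ → 1#) (λ _ → x)
            (λ _ → trans (trans (+-identityʳ _) (*-identityˡ _)) (trans (E≈α z≤n (Dist-refl x)) α₀≈0)) _))
          where
          x : Fin n
          x = proj₁ nonzero

        -- A diagonal entry of the eigenvalue equation: all neighbours of x contribute α 1.
        θα₀≈kα₁ : θ * α 0 ≈ fromℕ k * α 1
        θα₀≈kα₁ = trans (*-congˡ (sym (E≈α z≤n (Dist-refl x))))
          (eigen-constant (λ z x~z → E≈α 1≤t (Dist-sym (Adj⇒Dist x~z))))
          where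
          x : Fin n
          x = proj₁ nonzero

        α₁≉α₀ : ¬ θ ≈ fromℕ k → ¬ α 1 ≈ α 0
        α₁≉α₀ θ≉k α₁≈α₀ = θ≉k (*-cancelˡ α₀≉0 (begin
          α 0 * θ         ≈⟨ *-comm _ _ ⟩
          θ * α 0         ≈⟨ θα₀≈kα₁ ⟩
          fromℕ k * α 1   ≈⟨ *-congˡ α₁≈α₀ ⟩
          fromℕ k * α 0   ≈⟨ *-comm _ _ ⟩
          α 0 * fromℕ k   ∎))

        module _ (θ≉k : ¬ θ ≈ fromℕ k) (θ≉-k : ¬ θ ≈ - fromℕ k)
                 (connected : ∀ x y → ∃[ j ] HasDist x y j) where

          -- If rows at distance 2 coincide, then on a geodesic w₀ w₁ w₂ w₃ no neighbour of w₁ is adjacent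
          -- to w₂, so that all of them share the row of w₂ and θ² = k².
          α₂≉α₀ : ∀ {M w} → 3 ℕ.≤ M → IsGeodesic M w → ¬ α 2 ≈ α 0
          α₂≉α₀ {M} {w} 3≤M geo α₂≈α₀ = θ≉-k (x-y≈0⇒x≈y (trans (+-congˡ (-‿involutive _))
              (x*y≈0⇒y≈0 (λ θ-k≈0 → θ≉k (x-y≈0⇒x≈y θ-k≈0)) product≈0)))
            where
            ≤M : ∀ {i} → i ℕ.≤ 3 → i ℕ.≤ M
            ≤M i≤3 = ℕ.≤-trans i≤3 3≤M
            d : ∀ i j → i ℕ.≤ 3 → j ℕ.≤ 3 → HasDist (w i) (w j) ∣ i - j ∣
            d i j i≤3 j≤3 = geo i j (≤M i≤3) (≤M j≤3)
            d₀₁ = d 0 1 z≤n (s≤s z≤n)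
            d₀₂ = d 0 2 z≤n (s≤s (s≤s z≤n))
            d₀₃ = d 0 3 z≤n ℕ.≤-refl
            d₁₂ = d 1 2 (s≤s z≤n) (s≤s (s≤s z≤n))
            d₁₃ = d 1 3 (s≤s z≤n) ℕ.≤-refl
            d₂₃ = d 2 3 (s≤s (s≤s z≤n)) ℕ.≤-refl

            -- The vertices x and z at distance 2 share a row, so the entry at (z, y) is that at (x,
            -- y), namely α 1.
            adjacent-rows-differ : ∀ {x y z} → Adj x y → HasDist x z 2 → E z y ≈ α 0 → ⊥
            adjacent-rows-differ x~y dxz Ezy≈α₀ = α₁≉α₀ θ≉k
              (trans (sym (E≈α 1≤t (Adj⇒Dist x~y))) (trans (same-row 2≤t dxz α₂≈α₀ _) Ezy≈α₀))

            -- A common neighbour z of w 1 and w 2 would have to be adjacent to w 0: at distance 2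
            -- it would share the row of w 0, whose entry at w 2 is α 2 ≈ α 0. In the same way it
            -- would be adjacent to w 3, but w 0 and w 3 are at distance 3.
            not-adjacent : ∀ z → Adj (w 1) z → ¬ Adj z (w 2)
            not-adjacent z w₁~z z~w₂ with Dist-≤2 connected (Adj-sym w₁~z) (Adj-sym (Dist-1 d₀₁))
            ... | inj₁ dzw₀ = contradiction
                  (Dist-unique d₀₂ (≡.subst (λ u → HasDist u (w 2) 1) (Dist-0 dzw₀) (Adj⇒Dist z~w₂))) (λ ())
            ... | inj₂ (inj₂ dzw₀) =
                  adjacent-rows-differ z~w₂ dzw₀ (trans (E≈α 2≤t d₀₂) α₂≈α₀)
            ... | inj₂ (inj₁ dzw₀) with Dist-≤2 connected z~w₂ (Dist-1 d₂₃)
            ... | inj₁ dzw₃ = contradiction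
                  (Dist-unique d₁₃ (≡.subst (λ u → HasDist (w 1) u 1) (Dist-0 dzw₃) (Adj⇒Dist w₁~z))) (λ ())
            ... | inj₂ (inj₁ dzw₃) = contradiction (Dist-triangle (Dist-sym dzw₀) dzw₃ d₀₃) λ { (s≤s (s≤s ())) }
            ... | inj₂ (inj₂ dzw₃) =
                  adjacent-rows-differ (Adj-sym w₁~z) dzw₃ (trans (E≈α 2≤t (Dist-sym d₁₃)) α₂≈α₀)

            neighbour-row : ∀ z → Adj (w 1) z → E z (w 2) ≈ α 0
            neighbour-row z w₁~z with Dist-≤2 connected (Adj-sym w₁~z) (Dist-1 d₁₂)
            ... | inj₁ dz        = E≈α z≤n dz
            ... | inj₂ (inj₁ dz) = contradiction (Dist-1 dz) (not-adjacent z w₁~z)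
            ... | inj₂ (inj₂ dz) = trans (E≈α 2≤t dz) α₂≈α₀

            -- The entry of the eigenvalue equation at (w 1, w 2). Together with `θα₀≈kα₁` it gives
            -- θ² = k².
            θα₁≈kα₀ : θ * α 1 ≈ fromℕ k * α 0
            θα₁≈kα₀ = trans (*-congˡ (sym (E≈α 1≤t d₁₂))) (eigen-constant neighbour-row)

            θθ≈kk : θ * θ ≈ fromℕ k * fromℕ k
            θθ≈kk = *-cancelˡ α₀≉0 (begin
              α 0 * (θ * θ)               ≈⟨ *-comm _ _ ⟩
              θ * θ * α 0                 ≈⟨ *-assoc _ _ _ ⟩
              θ * (θ * α 0)               ≈⟨ *-congˡ θα₀≈kα₁ ⟩
              θ * (fromℕ k * α 1)         ≈⟨ *-assoc _ _ _ ⟨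
              θ * fromℕ k * α 1           ≈⟨ *-congʳ (*-comm _ _) ⟩
              fromℕ k * θ * α 1           ≈⟨ *-assoc _ _ _ ⟩
              fromℕ k * (θ * α 1)         ≈⟨ *-congˡ θα₁≈kα₀ ⟩
              fromℕ k * (fromℕ k * α 0)   ≈⟨ *-assoc _ _ _ ⟨
              fromℕ k * fromℕ k * α 0     ≈⟨ *-comm _ _ ⟩
              α 0 * (fromℕ k * fromℕ k)   ∎)

            product≈0 : (θ - fromℕ k) * (θ + fromℕ k) ≈ 0#
            product≈0 = begin
              (θ - κ) * (θ + κ)                    ≈⟨ distribʳ _ θ (- κ) ⟩
              θ * (θ + κ) + - κ * (θ + κ)          ≈⟨ +-cong (distribˡ θ θ κ) (sym (-‿distribˡ-* κ _)) ⟩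
              θ * θ + θ * κ - κ * (θ + κ)          ≈⟨ +-cong (+-cong θθ≈kk (*-comm θ κ)) (-‿cong (trans (distribˡ κ θ κ) (+-comm _ _))) ⟩
              κ * κ + κ * θ - (κ * κ + κ * θ)      ≈⟨ -‿inverseʳ _ ⟩
              0#                                   ∎
              where
              κ = fromℕ k

          -- The common neighbour y puts z and z′ at distance at most 2. Their rows agree, so
          -- evaluation at z gives α 0 for both, which excludes distances 1 and 2. The geodesic
          -- through z has length m + 1 ≥ 3, as `α₂≉α₀` requires.
          unique-extension : RankAtMost ℝ Γ t E → ∀ m → t ℕ.≤ m → UniqueExtension connected m
          unique-extension rank m t≤m {x} {y} {z} {z′} d y~z y~z′ dz dz′ with z Fin.≟ z′
          ... | yes z≡z′ = z≡z′
          ... | no  z≢z′ with geodesic connected m d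
          ... | w , ≡.refl , ≡.refl , geo
            with geodesic-cons connected geo (Adj-sym y~z) (Dist-sym dz)
               | geodesic-cons connected geo (Adj-sym y~z′) (Dist-sym dz′)
          ... | gz | gz′ with rank-relation rank (ℕ.m≤n⇒m≤1+n t≤m) gz
          ... | c , c≉0 , toeplitz with branches-agree (ℕ.m≤n⇒m≤1+n t≤m) gz gz′ (suc t) ℕ.≤-refl c c≉0 toeplitz z
                                      | Dist-≤2 connected (Adj-sym y~z) y~z′
          ... | _       | inj₁ d₀        = Dist-0 d₀
          ... | Ezz≈Ez′z | inj₂ (inj₁ d₁) = contradiction (trans (sym (E≈α 1≤t (Dist-sym d₁)))
                (trans (sym Ezz≈Ez′z) (E≈α z≤n (Dist-refl z)))) (α₁≉α₀ θ≉k)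
          ... | Ezz≈Ez′z | inj₂ (inj₂ d₂) = contradiction (trans (sym (E≈α 2≤t (Dist-sym d₂)))
                (trans (sym Ezz≈Ez′z) (E≈α z≤n (Dist-refl z)))) (α₂≉α₀ (s≤s (ℕ.≤-trans 2≤t t≤m)) gz)

open import Data.Nat using (_≤_)

theorem6p3 : (ℝ : Reals) (Γ : Graph) (t k : ℕ) → 2 ≤ t →
    Graph.Connected Γ → Graph.WalkRegular Γ t → Graph.Regular Γ k →
    (θ : Reals.Carrier ℝ) → ¬ Reals._≈_ ℝ θ (Reals.fromℕ ℝ k) →
    ¬ Reals._≈_ ℝ θ (Reals.-_ ℝ (Reals.fromℕ ℝ k)) →
    (E : Mat ℝ Γ) → WalkRegularIdempotent ℝ Γ t θ E → RankAtMost ℝ Γ t E →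
    Graph.DistanceRegular Γ
theorem6p3 ℝ Γ t@(suc t-1) k 2≤t connected (_ , walk-regular) regular θ θ≉k θ≉-k E
           (nonzero , E-sym , E-idem , eigen , α , E-α) rank =
  distanceRegular connected′ regular (proj₁ nonzero) λ s → walk-constant s
  where
  open WalkCounts Γ
  open Representation ℝ Γ
  connected′ : ∀ x y → ∃[ j ] HasDist x y j
  connected′ x y = proj₁ (connected x y) , Dist⇒HasDist x y _ (proj₂ (connected x y))
  unique : ∀ m → t ℕ.≤ m → UniqueExtension connected′ m
  unique = unique-extension E-sym E-idem
    (λ {j} {x} {y} j≤t d → E-α j x y j≤t (HasDist⇒Dist d))
    regular eigen 2≤t nonzero θ≉k θ≉-k connected′ rank
  walk-constant : ∀ s → WalkConstant s
  -- Taking s steps outward from t gives constancy up to s + t, which covers s without comparing s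
  -- with t. Writing t as a successor fits the starting point `suc i` of the induction.
  walk-constant s ℓ j x y x′ y′ j≤s d d′ = WalkConstant-+ connected′ unique
    (λ ℓ j x y x′ y′ j≤t d d′ → walk-regular ℓ j x y x′ y′ j≤t (HasDist⇒Dist d) (HasDist⇒Dist d′))
    s ℓ j x y x′ y′ (ℕ.≤-trans j≤s (ℕ.m≤m+n s t)) d d′
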